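{- Let $N\ge 2$ and $m\ge 1$ be integers and let $x^{(r,s)}_k$ ($1\le r,s\le N$, $1\le k\le m$) be elements of a commutative ring; set $x^{(r,s)}_{m+1}=0$ for all $1\le r,s\le N$. Let $G(N,m)$ be the $Nm\times Nm$ matrix which, as an $N\times N$ block matrix with $m\times m$ blocks, has $(r,s)$ block $$G_{rs}=\begin{cases}B_m(x^{(r,s)}_1,\dots,x^{(r,s)}_m), & r,s \text{ odd},\\ C_m(x^{(r,s)}_1,\dots,x^{(r,s)}_m), & r \text{ odd},\ s \text{ even},\\ D_m(x^{(r,s)}_1,\dots,x^{(r,s)}_m), & r \text{ even},\ s \text{ odd},\\ A_m(x^{(r,s)}_1,\dots,x^{(r,s)}_m), & r,s \text{ even}.\end{cases}$$ Then $$\det(G(N,m))=\prod_{i=1}^{m}\det(X_{(i,i+1)}).$$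
   Context: For elements $x_1,\dots,x_m$, the following are $m\times m$ matrices, given by their $(p,q)$ entries: $A_m(x_1,\dots,x_m)$ has entry $x_{m+1-\min(p,q)}$; $B_m(x_1,\dots,x_m)$ has entry $x_{\max(p,q)}$; $C_m(x_1,\dots,x_m)$ has entry $x_{\max(p,\,m+1-q)}$; $D_m(x_1,\dots,x_m)$ has entry $x_{\max(m+1-p,\,q)}$. For $1\le i\le m$, $X_{(i,i+1)}$ is the $N\times N$ matrix whose $(r,s)$ entry is $x^{(r,s)}_i-x^{(r,s)}_{i+1}$. -}

module Defs where

open import Algebra.Bundles using (CommutativeRing)
open import Data.Fin.Base using (Fin; zero; suc; toℕ; fromℕ<; punchIn; remQuot)
open import Data.Nat.Base as ℕ using (ℕ; zero; suc; _⊔_; _⊓_; _∸_; parity)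
open import Data.Nat.Properties using (_<?_)
open import Data.Parity.Base using (Parity; 0ℙ; 1ℙ)
open import Data.Product.Base using (_,_)
open import Data.Vec.Functional using (Vector)
open import Relation.Nullary.Decidable.Core using (yes; no)

-- Elements of Fin n are zero-based; ⟦ i ⟧ is the one-based index in 1, …, n.
⟦_⟧ : ∀ {n} → Fin n → ℕ
⟦ i ⟧ = suc (toℕ i)

module Matrices {c ℓ} (R : CommutativeRing c ℓ) where

  open CommutativeRing R hiding (zero)
  open import Algebra.Properties.Semiring.Sum semiring using (sum)
  open import Algebra.Properties.Semiring.Exp semiring using (_^_)
  open import Algebra.Properties.Monoid.Sum *-monoid public
    using () renaming (sum to product)

  Matrix : ℕ → Set c
  Matrix n = Fin n → Fin n → Carrier

  -- Laplace expansion along the first row.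
  det : ∀ {n} → Matrix n → Carrier
  det {zero}  M = 1#
  det {suc n} M =
    sum λ j → (- 1#) ^ toℕ j * (M zero j * det (λ r s → M (suc r) (punchIn j s)))

  -- One-based lookup x₁, …, xₘ, with xₘ₊₁ = 0. The values at 0 and beyond
  -- m + 1 are never used below.
  infixl 9 _!_
  _!_ : ∀ {m} → Vector Carrier m → ℕ → Carrier
  x ! zero = 0#
  _!_ {m} x (suc k) with k <? m
  ... | yes k<m = x (fromℕ< k<m)
  ... | no  _   = 0#

  A B C D : ∀ {m} → Vector Carrier m → Matrix m
  A {m} x p q = x ! (suc m ∸ (⟦ p ⟧ ⊓ ⟦ q ⟧))
  B {m} x p q = x ! (⟦ p ⟧ ⊔ ⟦ q ⟧)
  C {m} x p q = x ! (⟦ p ⟧ ⊔ (suc m ∸ ⟦ q ⟧))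
  D {m} x p q = x ! ((suc m ∸ ⟦ p ⟧) ⊔ ⟦ q ⟧)

  -- The arguments are the parities of the one-based block row and column.
  block : Parity → Parity → ∀ {m} → Vector Carrier m → Matrix m
  block 1ℙ 1ℙ = B
  block 1ℙ 0ℙ = C
  block 0ℙ 1ℙ = D
  block 0ℙ 0ℙ = A

  -- remQuot m sends the zero-based index r * m + p to (r , p): position p
  -- inside block r.
  G : ∀ N m → (Fin N → Fin N → Vector Carrier m) → Matrix (N ℕ.* m)
  G N m x i j with remQuot {N} m i | remQuot {N} m j
  ... | r , p | s , q = block (parity ⟦ r ⟧) (parity ⟦ s ⟧) (x r s) p q

  -- X x i is the matrix of differences of the entries with one-based indices
  -- ⟦ i ⟧ and ⟦ i ⟧ + 1.
  X : ∀ {N m} → (Fin N → Fin N → Vector Carrier m) → Fin m → Matrix N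
  X x i r s = x r s ! ⟦ i ⟧ - x r s ! suc ⟦ i ⟧

{-# OPTIONS --safe #-}
module Submission where

-- Reversing the order of the rows and columns inside every even-numbered block
-- turns each of A, B, C, D into B, and regrouping the indices by position
-- instead of by block then gives an m × m block matrix whose (p , q) block
-- consists of the entries with index max(p, q). Rows and columns are permuted
-- alike, so the determinant does not change: it is the only alternating
-- multilinear form taking the value 1 at the identity, and conjugating its
-- argument by a permutation yields such a form again. Subtracting the second
-- block row from the first leaves X₍₁,₂₎ followed by zeros, and induction on m
-- concludes.

open import Defs
open import Algebra.Bundles using (CommutativeRing)
open import Data.Fin.Base
  using (Fin; zero; suc; toℕ; fromℕ<; punchIn; lift; opposite; splitAt; remQuot; _↑ˡ_; _↑ʳ_)
open import Data.Fin.Properties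
  using (_≟_; toℕ<n; toℕ-injective; toℕ-fromℕ<; fromℕ<-toℕ; suc-injective; toℕ-↑ˡ;
         splitAt-↑ˡ; splitAt-↑ʳ; remQuot-combine; *↔×; opposite-prop; opposite-involutive)
open import Data.Nat.Base as ℕ using (ℕ; zero; suc; _≤_; z≤n; s≤s; parity)
import Data.Nat.Properties as ℕ
open import Data.Parity.Base using (Parity; 0ℙ; 1ℙ)
open import Data.Product.Base using (_×_; _,_; proj₁; proj₂; map₁)
open import Data.Sum.Base using (inj₁; inj₂; [_,_]′)
open import Data.Vec.Functional using (Vector; _∷_; head; tail; insertAt; removeAt; updateAt)
open import Data.Vec.Functional.Properties using (updateAt-updates; updateAt-minimal; updateAt-id-local)
open import Function.Base using (_∘_; const)
open import Function.Bundles using (_↔_; Inverse; Injection; mk↔ₛ′)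
open import Function.Properties.Inverse using (↔⇒↣; ↔-sym; ↔-trans)
open import Level using (_⊔_)
open import Relation.Binary.PropositionalEquality.Core as ≡ using (_≡_; _≢_; _≗_)
open import Relation.Nullary using (yes; no; contradiction)

module Determinants {c ℓ} (R : CommutativeRing c ℓ) where

  open CommutativeRing R hiding (zero)
  open Matrices R
  open import Algebra.Properties.Ring ring
  open import Algebra.Properties.Semiring.Sum semiring
  open import Algebra.Properties.Semiring.Exp semiring using (_^_)
  open import Relation.Binary.Reasoning.Setoid setoid
  open import Algebra.Solver.Ring.NaturalCoefficients.Default commutativeSemiring
    using (solve; con; _:=_; _:+_; _:*_)

  -- Sums, congruence and row linearity of the determinant

  sign : ∀ {n} → Fin n → Carrier
  sign j = (- 1#) ^ toℕ j

  minor : ∀ {n} → Fin (suc n) → (Fin n → Vector Carrier (suc n)) → Matrix n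
  minor j T r = removeAt (T r) j

  sum-zero : ∀ {n} {f : Vector Carrier n} → (∀ i → f i ≈ 0#) → sum f ≈ 0#
  sum-zero {n} f≈0 = trans (sum-cong-≋ f≈0) (sum-replicate-zero n)

  -‿sum : ∀ {n} (f : Vector Carrier n) → sum (-_ ∘ f) ≈ - sum f
  -‿sum f = begin
    sum (-_ ∘ f)               ≈⟨ sum-cong-≋ (λ i → sym (-1*x≈-x (f i))) ⟩
    sum (λ i → - 1# * f i)     ≈⟨ *-distribˡ-sum (- 1#) f ⟨
    - 1# * sum f               ≈⟨ -1*x≈-x (sum f) ⟩
    - sum f                    ∎

  det-cong : ∀ {n} {M M′ : Matrix n} → (∀ r s → M r s ≈ M′ r s) → det M ≈ det M′
  det-cong {zero}  eq = refl
  det-cong {suc n} eq = sum-cong-≋ λ j →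
    *-congˡ {sign j} (*-cong (eq zero j) (det-cong λ r s → eq (suc r) (punchIn j s)))

  -- One equation `a * M₁ i s + M₂ i s` covers additivity and homogeneity together. The other rows
  -- are compared entry by entry, so no function extensionality is involved. For row 0 the
  -- coefficients of the expansion are linear and the minors agree; for a later row the minors are
  -- linear by induction.
  det-linear : ∀ {n} (i : Fin n) a {M M₁ M₂ : Matrix n} →
    (∀ r → r ≢ i → ∀ s → M r s ≈ M₁ r s) →
    (∀ r → r ≢ i → ∀ s → M r s ≈ M₂ r s) →
    (∀ s → M i s ≈ a * M₁ i s + M₂ i s) →
    det M ≈ a * det M₁ + det M₂
  det-linear {suc n} i a {M} {M₁} {M₂} eq₁ eq₂ lin = begin
    det M                                  ≈⟨ sum-cong-≋ (term i eq₁ eq₂ lin) ⟩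
    sum (λ j → a * t M₁ j + t M₂ j)        ≈⟨ ∑-distrib-+ (λ j → a * t M₁ j) (t M₂) ⟩
    sum (λ j → a * t M₁ j) + det M₂        ≈⟨ +-congʳ (*-distribˡ-sum a (t M₁)) ⟨
    a * det M₁ + det M₂                    ∎
    where
    t : Matrix (suc n) → Fin (suc n) → Carrier
    t N j = sign j * (N zero j * det (minor j (tail N)))

    term : ∀ i →
      (∀ r → r ≢ i → ∀ s → M r s ≈ M₁ r s) →
      (∀ r → r ≢ i → ∀ s → M r s ≈ M₂ r s) →
      (∀ s → M i s ≈ a * M₁ i s + M₂ i s) →
      ∀ j → t M j ≈ a * t M₁ j + t M₂ j
    term zero eq₁ eq₂ lin j = begin
      t M j
        ≈⟨ *-congˡ (*-congʳ (lin j)) ⟩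
      sign j * ((a * M₁ zero j + M₂ zero j) * d)
        ≈⟨ solve 5 (λ s a u v d → s :* ((a :* u :+ v) :* d) := a :* (s :* (u :* d)) :+ s :* (v :* d))
             refl (sign j) a (M₁ zero j) (M₂ zero j) d ⟩
      a * (sign j * (M₁ zero j * d)) + sign j * (M₂ zero j * d)
        ≈⟨ +-cong (*-congˡ (*-congˡ (*-congˡ (det-cong λ r s → eq₁ (suc r) (λ ()) (punchIn j s)))))
                  (*-congˡ (*-congˡ (det-cong λ r s → eq₂ (suc r) (λ ()) (punchIn j s)))) ⟩
      a * t M₁ j + t M₂ j
        ∎
      where d = det (minor j (tail M))
    term (suc i) eq₁ eq₂ lin j = begin
      t M j
        ≈⟨ *-congˡ (*-congˡ (det-linear i a
             (λ r r≢i s → eq₁ (suc r) (r≢i ∘ suc-injective) (punchIn j s))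
             (λ r r≢i s → eq₂ (suc r) (r≢i ∘ suc-injective) (punchIn j s))
             (λ s → lin (punchIn j s)))) ⟩
      sign j * (M zero j * (a * d₁ + d₂))
        ≈⟨ solve 5 (λ s m a d₁ d₂ → s :* (m :* (a :* d₁ :+ d₂)) := a :* (s :* (m :* d₁)) :+ s :* (m :* d₂))
             refl (sign j) (M zero j) a d₁ d₂ ⟩
      a * (sign j * (M zero j * d₁)) + sign j * (M zero j * d₂)
        ≈⟨ +-cong (*-congˡ (*-congˡ (*-congʳ (eq₁ zero (λ ()) j))))
                  (*-congˡ (*-congʳ (eq₂ zero (λ ()) j))) ⟩
      a * t M₁ j + t M₂ j
        ∎
      where
      d₁ = det (minor j (tail M₁))
      d₂ = det (minor j (tail M₂))

  -- Alternating multilinear forms and row operations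

  -- The row length `k` is independent of the number `n` of rows, so that fixing the first row of a
  -- square matrix leaves a form of the same kind.
  record Alternating {n k} (F : (Fin n → Vector Carrier k) → Carrier) : Set (c ⊔ ℓ) where
    field
      cong : ∀ {M M′} → (∀ r s → M r s ≈ M′ r s) → F M ≈ F M′
      linear : ∀ i a {M M₁ M₂} →
        (∀ r → r ≢ i → ∀ s → M r s ≈ M₁ r s) →
        (∀ r → r ≢ i → ∀ s → M r s ≈ M₂ r s) →
        (∀ s → M i s ≈ a * M₁ i s + M₂ i s) →
        F M ≈ a * F M₁ + F M₂
      equal-rows : ∀ i j {M} → i ≢ j → (∀ s → M i s ≈ M j s) → F M ≈ 0#

    zero-row : ∀ i {M} → (∀ s → M i s ≈ 0#) → F M ≈ 0#
    zero-row i {M} Mi≈0 = begin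
      -- `M` serves as both comparison matrices: a zero row is -1 times itself plus itself.
      F M                ≈⟨ linear i (- 1#) (λ _ _ _ → refl) (λ _ _ _ → refl) (λ s →
                              trans (Mi≈0 s) (sym (cancel (M i s)))) ⟩
      - 1# * F M + F M   ≈⟨ cancel (F M) ⟩
      0#                 ∎
      where
      cancel : ∀ x → - 1# * x + x ≈ 0#
      cancel x = trans (+-congʳ (-1*x≈-x x)) (-‿inverseˡ x)

    additive : ∀ i {M M₁ M₂} →
      (∀ r → r ≢ i → ∀ s → M r s ≈ M₁ r s) →
      (∀ r → r ≢ i → ∀ s → M r s ≈ M₂ r s) →
      (∀ s → M i s ≈ M₁ i s + M₂ i s) →
      F M ≈ F M₁ + F M₂
    additive i eq₁ eq₂ add = trans
      (linear i 1# eq₁ eq₂ (λ s → trans (add s) (+-congʳ (sym (*-identityˡ _)))))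
      (+-congʳ (*-identityˡ _))

  open Alternating

  module _ {n k} {F : (Fin (suc n) → Vector Carrier k) → Carrier} (alt : Alternating F) where

    private
      at : (Fin n → Vector Carrier k) → Fin n → Vector Carrier k → Fin n → Vector Carrier k
      at T i v = updateAt T i (const v)

      at-here : ∀ T i v s → at T i v i s ≡ v s
      at-here T i v s = ≡.cong (λ u → u s) (updateAt-updates i T)

      at-there : ∀ T i v r s → r ≢ i → at T i v r s ≡ T r s
      at-there T i v r s r≢i = ≡.cong (λ u → u s) (updateAt-minimal r i T r≢i)

    -- Polarisation: with `u + v` in both rows the form vanishes, and so do the two diagonal terms
    -- of its expansion, which leaves the two mixed terms with sum zero.
    swap-rows : ∀ (T : Fin n → Vector Carrier k) i u v →
      F (u ∷ updateAt T i (const v)) ≈ - F (v ∷ updateAt T i (const u))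
    swap-rows T i u v = +-inverseˡ-unique _ _ (begin
      P u v + P v u                        ≈⟨ +-cong (+-identityˡ _) (+-identityʳ _) ⟨
      (0# + P u v) + (P v u + 0#)          ≈⟨ +-cong (+-congʳ (diagonal u)) (+-congˡ (diagonal v)) ⟨
      (P u u + P u v) + (P v u + P v v)    ≈⟨ +-cong (second u) (second v) ⟨
      P u w + P v w                        ≈⟨ first ⟨
      P w w                                ≈⟨ diagonal w ⟩
      0#                                   ∎)
      where
      P : Vector Carrier k → Vector Carrier k → Carrier
      P y z = F (y ∷ at T i z)

      w : Vector Carrier k
      w s = u s + v s

      diagonal : ∀ y → P y y ≈ 0#
      diagonal y = equal-rows alt zero (suc i) (λ ()) λ s → reflexive (≡.sym (at-here T i y s))

      first : P w w ≈ P u w + P v w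
      first = additive alt zero
        (λ { zero 0≢0 → contradiction ≡.refl 0≢0 ; (suc r) _ s → refl })
        (λ { zero 0≢0 → contradiction ≡.refl 0≢0 ; (suc r) _ s → refl })
        (λ s → refl)

      other : ∀ y z z′ r → r ≢ suc i → ∀ s → (y ∷ at T i z) r s ≈ (y ∷ at T i z′) r s
      other y z z′ zero    _ s = refl
      other y z z′ (suc r) r≢i s = reflexive (≡.trans
        (at-there T i z r s (r≢i ∘ ≡.cong suc)) (≡.sym (at-there T i z′ r s (r≢i ∘ ≡.cong suc))))

      second : ∀ y → P y w ≈ P y u + P y v
      second y = additive alt (suc i) (other y w u) (other y w v) λ s → reflexive
        (≡.trans (at-here T i w s)
          (≡.cong₂ _+_ (≡.sym (at-here T i u s)) (≡.sym (at-here T i v s))))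

  -- All row operations are performed at once. The condition on `a ∘ f` says that every source row
  -- is itself left unchanged, so the operations do not interfere and can be undone one by one.
  add-rows : ∀ {n k} {F : (Fin n → Vector Carrier k) → Carrier} → Alternating F →
    ∀ M (f : Fin n → Fin n) (a : Vector Carrier n) → (∀ i → a (f i) ≈ 0#) →
    F (λ i s → M i s + a i * M (f i) s) ≈ F M
  add-rows {n} {k} {F} alt M f a a∘f≈0 = go n ℕ.≤-refl a a∘f≈0 (λ i n≤i → contradiction (toℕ<n i) (ℕ.≤⇒≯ n≤i))
    where
    modified : Vector Carrier n → Fin n → Vector Carrier k
    modified a i s = M i s + a i * M (f i) s

    unmodified : ∀ a {i} → a i ≈ 0# → ∀ s → modified a i s ≈ M i s
    unmodified a ai≈0 s = trans (+-congˡ (trans (*-congʳ ai≈0) (zeroˡ _))) (+-identityʳ _)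

    -- The bound `t` limits the support of `a`: rows from `t` on are unmodified. Each round sets the
    -- last possibly nonzero coefficient, that of row `t - 1`, to zero.
    go : ∀ t → t ≤ n → ∀ a → (∀ i → a (f i) ≈ 0#) → (∀ i → t ≤ toℕ i → a i ≈ 0#) →
         F (modified a) ≈ F M
    go zero    _   a _     a≈0  = cong alt λ r → unmodified a (a≈0 r z≤n)
    go (suc t) t<n a a∘f≈0 tail≈0 = begin
      F (modified a)                          ≈⟨ linear alt i (a i) other₁ other₂ here ⟩
      a i * F replaced + F (modified a′)      ≈⟨ +-cong vanish (go t (ℕ.<⇒≤ t<n) a′ a′∘f≈0 a′-tail) ⟩
      0# + F M                                ≈⟨ +-identityˡ _ ⟩
      F M                                     ∎
      where
      i : Fin n
      i = fromℕ< t<n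

      a′ : Vector Carrier n
      a′ = updateAt a i (const 0#)

      a′-here : a′ i ≡ 0#
      a′-here = updateAt-updates i a

      a′-there : ∀ j → j ≢ i → a′ j ≡ a j
      a′-there j = updateAt-minimal j i a

      a′∘f≈0 : ∀ j → a′ (f j) ≈ 0#
      a′∘f≈0 j with f j ≟ i
      ... | yes fj≡i = reflexive (≡.trans (≡.cong a′ fj≡i) a′-here)
      ... | no  fj≢i = trans (reflexive (a′-there (f j) fj≢i)) (a∘f≈0 j)

      a′-tail : ∀ j → t ≤ toℕ j → a′ j ≈ 0#
      a′-tail j t≤j with j ≟ i
      ... | yes ≡.refl = reflexive a′-here
      ... | no  j≢i = trans (reflexive (a′-there j j≢i)) (tail≈0 j (ℕ.≤∧≢⇒< t≤j λ t≡j →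
              j≢i (toℕ-injective (≡.trans (≡.sym t≡j) (≡.sym (toℕ-fromℕ< t<n))))))

      replaced : Fin n → Vector Carrier k
      replaced = updateAt (modified a′) i (const (M (f i)))

      replaced-here : ∀ s → replaced i s ≡ M (f i) s
      replaced-here s = ≡.cong (λ u → u s) (updateAt-updates i (modified a′))

      replaced-there : ∀ r → r ≢ i → ∀ s → replaced r s ≡ modified a′ r s
      replaced-there r r≢i s = ≡.cong (λ u → u s) (updateAt-minimal r i (modified a′) r≢i)

      other₂ : ∀ r → r ≢ i → ∀ s → modified a r s ≈ modified a′ r s
      other₂ r r≢i s = +-congˡ (*-congʳ (reflexive (≡.sym (a′-there r r≢i))))

      other₁ : ∀ r → r ≢ i → ∀ s → modified a r s ≈ replaced r s
      other₁ r r≢i s = trans (other₂ r r≢i s) (reflexive (≡.sym (replaced-there r r≢i s)))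

      here : ∀ s → modified a i s ≈ a i * replaced i s + modified a′ i s
      here s = begin
        M i s + a i * M (f i) s                ≈⟨ +-comm _ _ ⟩
        a i * M (f i) s + M i s
          ≈⟨ +-cong (*-congˡ (reflexive (replaced-here s))) (unmodified a′ (reflexive a′-here) s) ⟨
        a i * replaced i s + modified a′ i s   ∎

      vanish : a i * F replaced ≈ 0#
      -- If row `i` is its own source, its coefficient is zero by hypothesis; otherwise `replaced`
      -- contains the unmodified row `f i` twice.
      vanish with f i ≟ i
      ... | yes fi≡i = trans (*-congʳ (trans (reflexive (≡.cong a (≡.sym fi≡i))) (a∘f≈0 i))) (zeroˡ _)
      ... | no  fi≢i = trans (*-congˡ (equal-rows alt i (f i) (fi≢i ∘ ≡.sym) λ s → begin
              replaced i s          ≡⟨ replaced-here s ⟩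
              M (f i) s             ≈⟨ unmodified a′ (a′∘f≈0 i) s ⟨
              modified a′ (f i) s   ≡⟨ replaced-there (f i) fi≢i s ⟨
              replaced (f i) s      ∎)) (zeroʳ _)

  -- The determinant is alternating

  -- The double Laplace expansion along two equal rows: the terms for the
  -- column pairs (j , punchIn j l) and (punchIn j l , j) cancel.
  laplace-cancel : ∀ {n} (a : Vector Carrier (suc (suc n)))
    (D : (Fin n → Fin (suc (suc n))) → Carrier) → (∀ {e e′} → e ≗ e′ → D e ≈ D e′) →
    sum (λ j → sign j * (a j * sum (λ l →
      sign l * (a (punchIn j l) * D (λ s → punchIn j (punchIn l s)))))) ≈ 0#
  laplace-cancel {n} a D D-cong = begin
    1# * (a zero * sum Z) + sum (λ j → sign (suc j) * (a (suc j) * sum (w j)))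
      ≈⟨ +-cong (trans (*-identityˡ _) (*-distribˡ-sum (a zero) Z)) (sum-cong-≋ split) ⟩
    sum (λ j → a zero * Z j) + sum (λ j → - (a zero * Z j) + rest j)
      ≈⟨ +-congˡ (∑-distrib-+ (λ j → - (a zero * Z j)) rest) ⟩
    sum (λ j → a zero * Z j) + (sum (λ j → - (a zero * Z j)) + sum rest)
      ≈⟨ +-congˡ (+-cong (-‿sum (λ j → a zero * Z j)) (rest≈0 a D D-cong)) ⟩
    sum (λ j → a zero * Z j) + (- sum (λ j → a zero * Z j) + 0#)
      ≈⟨ +-congˡ (+-identityʳ _) ⟩
    sum (λ j → a zero * Z j) - sum (λ j → a zero * Z j)
      ≈⟨ -‿inverseʳ _ ⟩
    0#
      ∎
    where
    -- `Z` belongs to the column pairs (0, l + 1). By `split` the pairs (j + 1, 0) give the same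
    -- terms with the opposite sign, and `rest` collects the pairs avoiding column 0, where the two
    -- extra signs cancel.
    Z : Vector Carrier (suc n)
    Z l = sign l * (a (suc l) * D (λ s → suc (punchIn l s)))

    w : Fin (suc n) → Vector Carrier (suc n)
    w j l = sign l * (a (punchIn (suc j) l) * D (λ s → punchIn (suc j) (punchIn l s)))

    v : Fin (suc n) → Vector Carrier n
    v j l = sign l * (a (suc (punchIn j l)) * D (λ s → punchIn (suc j) (punchIn (suc l) s)))

    rest : Vector Carrier (suc n)
    rest j = sign j * (a (suc j) * sum (v j))

    split : ∀ j → sign (suc j) * (a (suc j) * sum (w j)) ≈ - (a zero * Z j) + rest j
    split j = begin
      - 1# * sign j * (a (suc j) * (1# * (a zero * d) + sum (λ l → sign (suc l) * y l)))
        ≈⟨ *-congˡ (*-congˡ (+-congˡ (begin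
             sum (λ l → - 1# * sign l * y l)     ≈⟨ sum-cong-≋ (λ l → *-assoc (- 1#) (sign l) (y l)) ⟩
             sum (λ l → - 1# * v j l)            ≈⟨ *-distribˡ-sum (- 1#) (v j) ⟨
             - 1# * sum (v j)                    ∎))) ⟩
      - 1# * sign j * (a (suc j) * (1# * (a zero * d) + - 1# * sum (v j)))
        ≈⟨ solve 6 (λ e s aj a₀ d S →
             e :* s :* (aj :* (con 1 :* (a₀ :* d) :+ e :* S)) :=
             e :* (a₀ :* (s :* (aj :* d))) :+ e :* (e :* (s :* (aj :* S))))
             refl (- 1#) (sign j) (a (suc j)) (a zero) d (sum (v j)) ⟩
      - 1# * (a zero * Z j) + - 1# * (- 1# * rest j)
        ≈⟨ +-cong (-1*x≈-x _) (trans (-1*x≈-x _) (trans (-‿cong (-1*x≈-x _)) (-‿involutive _))) ⟩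
      - (a zero * Z j) + rest j
        ∎
      where
      d : Carrier
      d = D (λ s → suc (punchIn j s))

      y : Vector Carrier n
      y l = a (suc (punchIn j l)) * D (λ s → punchIn (suc j) (punchIn (suc l) s))

    -- Column 0 survives in all these minors, so this is the same double sum for the remaining
    -- columns, with `D` precomposed with `lift 1`.
    rest≈0 : ∀ {n} (a : Vector Carrier (suc (suc n)))
      (D : (Fin n → Fin (suc (suc n))) → Carrier) → (∀ {e e′} → e ≗ e′ → D e ≈ D e′) →
      sum {suc n} (λ j → sign j * (a (suc j) * sum {n} (λ l →
        sign l * (a (suc (punchIn j l)) * D (λ s → punchIn (suc j) (punchIn (suc l) s)))))) ≈ 0#
    rest≈0 {zero}  a D D-cong = trans (+-identityʳ _) (trans (*-identityˡ _) (zeroʳ _))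
    rest≈0 {suc n} a D D-cong = trans
      (sum-cong-≋ λ j → *-congˡ {sign j} (*-congˡ {a (suc j)} (sum-cong-≋ λ l →
        *-congˡ {sign l} (*-congˡ {a (suc (punchIn j l))} (D-cong (lifted j l))))))
      (laplace-cancel (tail a) (D ∘ lift 1)
        (λ e≗e′ → D-cong (λ { zero → ≡.refl ; (suc s) → ≡.cong suc (e≗e′ s) })))
      where
      lifted : ∀ (j : Fin (suc (suc n))) l s →
        punchIn (suc j) (punchIn (suc l) s) ≡ lift 1 (λ s → punchIn j (punchIn l s)) s
      lifted j l zero    = ≡.refl
      lifted j l (suc s) = ≡.refl

  det-equal-heads : ∀ {n} (M : Matrix (suc (suc n))) →
    (∀ s → M zero s ≈ M (suc zero) s) → det M ≈ 0#
  det-equal-heads M eq = trans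
    (sum-cong-≋ λ j → *-congˡ {sign j} (*-congʳ {det (minor j (tail M))} (eq j)))
    (laplace-cancel (M (suc zero)) (λ e → det (λ r s → M (suc (suc r)) (e s)))
      (λ e≗e′ → det-cong λ r s → reflexive (≡.cong (M (suc (suc r))) (e≗e′ s))))

  -- Induction on the size, mutual with the next lemma. Two equal rows below the first stay equal in
  -- every minor. If the first row is one of them, the other is swapped up to row 1, a swap among
  -- the lower rows that only uses smaller determinants, and `det-equal-heads` applies.
  det-alternating : ∀ {n} → Alternating (det {n})

  det-tail-alternating : ∀ {n} (u : Vector Carrier (suc n)) → Alternating {n} (λ T → det (u ∷ T))
  det-tail-alternating u .cong {M} {M′} eq = det-cong {M = u ∷ M} {u ∷ M′} λ { zero s → refl ; (suc r) → eq r }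
  det-tail-alternating u .linear i a {M} {M₁} {M₂} eq₁ eq₂ lin = det-linear (suc i) a {u ∷ M} {u ∷ M₁} {u ∷ M₂}
    (λ { zero _ s → refl ; (suc r) r≢i → eq₁ r (r≢i ∘ ≡.cong suc) })
    (λ { zero _ s → refl ; (suc r) r≢i → eq₂ r (r≢i ∘ ≡.cong suc) })
    lin
  det-tail-alternating u .equal-rows i k i≢k eq = sum-zero λ j →
    trans (*-congˡ {sign j} (trans
      (*-congˡ {u j} (equal-rows det-alternating i k i≢k (λ s → eq (punchIn j s))))
      (zeroʳ _))) (zeroʳ _)

  det-alternating .cong = det-cong
  det-alternating .linear = det-linear
  det-alternating .equal-rows = equal
    where
    cons-head-tail : ∀ {n} (M : Matrix (suc n)) → det M ≈ det (head M ∷ tail M)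
    cons-head-tail M = det-cong {M = M} {head M ∷ tail M} λ { zero s → refl ; (suc r) s → refl }

    head-equal : ∀ {n} k {M : Matrix (suc n)} → (∀ s → M zero s ≈ M (suc k) s) → det M ≈ 0#
    head-equal zero {M} eq = det-equal-heads M eq
    head-equal {suc (suc n)} (suc k) {M} eq = begin
      det M
        ≈⟨ det-cong {M = M} rows ⟩
      det (head M ∷ (tail M zero ∷ updateAt T k (const (T k))))
        ≈⟨ swap-rows (det-tail-alternating (head M)) T k (tail M zero) (T k) ⟩
      - det swapped
        ≈⟨ -‿cong (det-equal-heads swapped eq) ⟩
      - 0#
        ≈⟨ -0#≈0# ⟩
      0#
        ∎
      where
      T : Fin (suc n) → Vector Carrier (suc (suc (suc n)))
      T = tail (tail M)

      swapped : Matrix (suc (suc (suc n)))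
      swapped = head M ∷ (T k ∷ updateAt T k (const (tail M zero)))

      rows : ∀ r s → M r s ≈ (head M ∷ (tail M zero ∷ updateAt T k (const (T k)))) r s
      rows zero          s = refl
      rows (suc zero)    s = refl
      rows (suc (suc r)) s = reflexive (≡.cong (λ u → u s) (≡.sym (updateAt-id-local k T ≡.refl r)))

    equal : ∀ {n} i j {M : Matrix n} → i ≢ j → (∀ s → M i s ≈ M j s) → det M ≈ 0#
    equal zero    zero    0≢0 _  = contradiction ≡.refl 0≢0
    equal zero    (suc j) {M} _ eq = head-equal j {M} eq
    equal (suc i) zero    {M} _ eq = head-equal i {M} (sym ∘ eq)
    equal (suc i) (suc j) {M} i≢j eq =
      trans (cons-head-tail M) (equal-rows (det-tail-alternating (head M)) i j (i≢j ∘ ≡.cong suc) eq)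

  -- Linear functionals and operations preserving alternating forms

  IsLinear : ∀ {n} → (Vector Carrier n → Carrier) → Set (c ⊔ ℓ)
  IsLinear φ = ∀ a {u v w} → (∀ s → u s ≈ a * v s + w s) → φ u ≈ a * φ v + φ w

  -- Linearity is stated for vectors related entry by entry, so the coefficient 0 already gives
  -- congruence.
  linear⇒cong : ∀ {n} {φ : Vector Carrier n → Carrier} → IsLinear φ →
    ∀ {u v} → (∀ s → u s ≈ v s) → φ u ≈ φ v
  linear⇒cong {φ = φ} lin {u} {v} u≈v = begin
    φ u                ≈⟨ lin 0# (λ s → trans (u≈v s) (sym (absorb (v s)))) ⟩
    0# * φ v + φ v     ≈⟨ absorb (φ v) ⟩
    φ v                ∎
    where
    absorb : ∀ x → 0# * x + x ≈ x
    absorb x = trans (+-congʳ (zeroˡ x)) (+-identityˡ x)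

  alternating-tail : ∀ {n k} {F : (Fin (suc n) → Vector Carrier k) → Carrier} →
    Alternating F → ∀ u → Alternating (λ T → F (u ∷ T))
  alternating-tail alt u .cong eq = cong alt λ { zero s → refl ; (suc r) → eq r }
  alternating-tail alt u .linear i a eq₁ eq₂ = linear alt (suc i) a
    (λ { zero _ s → refl ; (suc r) r≢i → eq₁ r (r≢i ∘ ≡.cong suc) })
    (λ { zero _ s → refl ; (suc r) r≢i → eq₂ r (r≢i ∘ ≡.cong suc) })
  alternating-tail alt u .equal-rows i j i≢j = equal-rows alt (suc i) (suc j) (i≢j ∘ suc-injective)

  alternating-map : ∀ {n k l} {F : (Fin n → Vector Carrier l) → Carrier} → Alternating F →
    {φ : Vector Carrier k → Vector Carrier l} → (∀ s → IsLinear (λ u → φ u s)) →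
    Alternating (λ M → F (φ ∘ M))
  alternating-map alt lin .cong eq = cong alt λ r s → linear⇒cong (lin s) (eq r)
  alternating-map alt lin .linear i a eq₁ eq₂ eq = linear alt i a
    (λ r r≢i s → linear⇒cong (lin s) (eq₁ r r≢i))
    (λ r r≢i s → linear⇒cong (lin s) (eq₂ r r≢i))
    (λ s → lin s a eq)
  alternating-map alt lin .equal-rows i j i≢j eq =
    equal-rows alt i j i≢j λ s → linear⇒cong (lin s) eq

  -- A bijection sends distinct rows to distinct rows, so each condition on row `i` transfers to row
  -- `from i`. The two sizes may be different expressions, as with `N * m` and `m * N`.
  alternating-reindex : ∀ {n m k} {F : (Fin n → Vector Carrier k) → Carrier} → Alternating F →
    (π : Fin n ↔ Fin m) → Alternating (λ M → F (M ∘ Inverse.to π))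
  alternating-reindex alt π .cong eq = cong alt λ r → eq (Inverse.to π r)
  alternating-reindex alt π .linear i a {M} {M₁} {M₂} eq₁ eq₂ eq = linear alt (from i) a
    (λ r r≢ → eq₁ (to r) (λ to≡i → r≢ (≡.trans (≡.sym (strictlyInverseʳ r)) (≡.cong from to≡i))))
    (λ r r≢ → eq₂ (to r) (λ to≡i → r≢ (≡.trans (≡.sym (strictlyInverseʳ r)) (≡.cong from to≡i))))
    (≡.subst (λ j → ∀ s → M j s ≈ a * M₁ j s + M₂ j s) (≡.sym (strictlyInverseˡ i)) eq)
    where open Inverse π
  alternating-reindex alt π .equal-rows i j {M} i≢j eq = equal-rows alt (from i) (from j)
    (λ eq → i≢j (≡.trans (≡.sym (strictlyInverseˡ i)) (≡.trans (≡.cong to eq) (strictlyInverseˡ j))))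
    (≡.subst₂ (λ p q → ∀ s → M p s ≈ M q s) (≡.sym (strictlyInverseˡ i)) (≡.sym (strictlyInverseˡ j)) eq)
    where open Inverse π

  -- The identity matrix and uniqueness of the determinant

  -- The rows of the identity matrix. By recursion on the row, the tail of a later row is
  -- definitionally a row of the smaller identity.
  δ : ∀ {n} → Matrix n
  δ zero    = 1# ∷ const 0#
  δ (suc i) = 0# ∷ δ i

  δ-diagonal : ∀ {n} (i : Fin n) → δ i i ≡ 1#
  δ-diagonal zero    = ≡.refl
  δ-diagonal (suc i) = δ-diagonal i

  δ-off-diagonal : ∀ {n} (i j : Fin n) → i ≢ j → δ i j ≡ 0#
  δ-off-diagonal zero    zero    0≢0 = contradiction ≡.refl 0≢0
  δ-off-diagonal zero    (suc j) _   = ≡.refl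
  δ-off-diagonal (suc i) zero    _   = ≡.refl
  δ-off-diagonal (suc i) (suc j) i≢j = δ-off-diagonal i j (i≢j ∘ ≡.cong suc)

  δ-injective : ∀ {n m} (f : Fin n → Fin m) → (∀ {i j} → f i ≡ f j → i ≡ j) →
    ∀ i j → δ (f i) (f j) ≡ δ i j
  δ-injective f inj i j with i ≟ j
  ... | yes ≡.refl = ≡.trans (δ-diagonal (f i)) (≡.sym (δ-diagonal i))
  ... | no  i≢j    = ≡.trans (δ-off-diagonal (f i) (f j) (i≢j ∘ inj)) (≡.sym (δ-off-diagonal i j i≢j))

  det-δ : ∀ n → det (δ {n}) ≈ 1#
  det-δ zero    = refl
  det-δ (suc n) = begin
    1# * (1# * det (δ {n})) + sum {n} (λ j → sign (suc j) * (0# * det (minor (suc j) (tail δ))))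
      ≈⟨ +-cong (trans (*-identityˡ _) (trans (*-identityˡ _) (det-δ n)))
                (sum-zero {n} λ j → trans
                  (*-congˡ {sign (suc j)} (zeroˡ (det (minor (suc j) (tail δ))))) (zeroʳ _)) ⟩
    1# + 0#
      ≈⟨ +-identityʳ 1# ⟩
    1#
      ∎

  linear-expansion : ∀ {n} {φ : Vector Carrier n → Carrier} → IsLinear φ →
    ∀ u → φ u ≈ sum (λ j → u j * φ (δ j))
  linear-expansion {zero} {φ} lin u = begin
    -- Any linear relation holds between empty vectors, in particular `u = - u + u`.
    φ u                  ≈⟨ lin (- 1#) (λ ()) ⟩
    - 1# * φ u + φ u     ≈⟨ +-congʳ (-1*x≈-x _) ⟩
    - φ u + φ u          ≈⟨ -‿inverseˡ _ ⟩
    0#                   ∎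
  linear-expansion {suc n} {φ} lin u = begin
    φ u
      ≈⟨ lin (u zero) (λ
           { zero    → sym (trans (+-identityʳ _) (*-identityʳ _))
           ; (suc s) → sym (trans (+-congʳ (zeroʳ _)) (+-identityˡ _)) }) ⟩
    u zero * φ (δ zero) + φ (0# ∷ tail u)
      ≈⟨ +-congˡ (linear-expansion {φ = φ ∘ (0# ∷_)} lin-tail (tail u)) ⟩
    u zero * φ (δ zero) + sum (λ j → u (suc j) * φ (δ (suc j)))
      ∎
    where
    lin-tail : IsLinear (φ ∘ (0# ∷_))
    lin-tail a eq = lin a λ
      { zero → sym (trans (+-identityʳ _) (zeroʳ a)) ; (suc s) → eq s }

  insertAt-linear : ∀ {n} (j : Fin (suc n)) s → IsLinear (λ u → insertAt u j 0# s)
  insertAt-linear         zero    zero    a eq = sym (trans (+-identityʳ _) (zeroʳ a))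
  insertAt-linear         zero    (suc s) a eq = eq s
  insertAt-linear {suc n} (suc j) zero    a eq = eq zero
  insertAt-linear {suc n} (suc j) (suc s) a eq = insertAt-linear j s a (eq ∘ suc)

  -- The effect on a row of subtracting a multiple of the unit row `δ j`: the entry in column `j` is
  -- cleared and the rest, a row of the minor, stays.
  clear-column : ∀ {n} (v : Vector Carrier (suc n)) j s →
    v s + - v j * δ j s ≈ insertAt (removeAt v j) j 0# s
  clear-column         v zero    zero    = trans (+-congˡ (*-identityʳ _)) (-‿inverseʳ _)
  clear-column         v zero    (suc s) = trans (+-congˡ (zeroʳ _)) (+-identityʳ _)
  clear-column {suc n} v (suc j) zero    = trans (+-congˡ (zeroʳ _)) (+-identityʳ _)
  clear-column {suc n} v (suc j) (suc s) = clear-column (tail v) j s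

  -- The argument is the identity with row `j` moved to the top, a cycle of `j` adjacent swaps. One
  -- swap brings `δ zero` to the top; the rest is the same statement for `j - 1` with the first row
  -- and column fixed in `F′`.
  unit-row-sign : ∀ {n} {F : Matrix (suc n) → Carrier} → Alternating F → ∀ j →
    F (δ j ∷ λ r → insertAt (δ r) j 0#) ≈ sign j * F δ
  unit-row-sign alt zero = trans
    (cong alt λ { zero s → refl ; (suc r) zero → refl ; (suc r) (suc s) → refl })
    (sym (*-identityˡ _))
  unit-row-sign {suc n} {F} alt (suc j) = begin
    F (δ (suc j) ∷ λ r → insertAt (δ r) (suc j) 0#)
      ≈⟨ cong alt (λ
           { zero                    → λ s → refl
           ; (suc zero)    zero      → refl
           ; (suc zero)    (suc s)   → insert-zero j s
           ; (suc (suc r)) zero      → refl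
           ; (suc (suc r)) (suc s)   → refl }) ⟩
    F (δ (suc j) ∷ updateAt (δ zero ∷ rest) zero (const (δ zero)))
      ≈⟨ swap-rows alt (δ zero ∷ rest) zero (δ (suc j)) (δ zero) ⟩
    - F (δ zero ∷ updateAt (δ zero ∷ rest) zero (const (δ (suc j))))
      ≈⟨ -‿cong (cong alt (λ
           { zero                    → λ s → refl
           ; (suc zero)              → λ s → refl
           ; (suc (suc r)) zero      → refl
           ; (suc (suc r)) (suc s)   → refl })) ⟩
    - F′ (δ j ∷ λ r → insertAt (δ r) j 0#)
      ≈⟨ -‿cong (unit-row-sign alt′ j) ⟩
    - (sign j * F′ δ)
      ≈⟨ -‿cong (*-congˡ (cong alt λ { zero s → refl ; (suc r) s → refl })) ⟩
    - (sign j * F δ)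
      ≈⟨ -1*x≈-x _ ⟨
    - 1# * (sign j * F δ)
      ≈⟨ *-assoc (- 1#) (sign j) (F δ) ⟨
    sign (suc j) * F δ
      ∎
    where
    rest : Fin n → Vector Carrier (suc (suc n))
    rest r = insertAt (δ (suc r)) (suc j) 0#

    F′ : Matrix (suc n) → Carrier
    F′ N = F (δ zero ∷ λ r → 0# ∷ N r)

    alt′ : Alternating F′
    alt′ = alternating-map (alternating-tail alt (δ zero)) {0# ∷_} λ
      { zero    a eq → sym (trans (+-identityʳ _) (zeroʳ a))
      ; (suc s) a eq → eq s }

    insert-zero : ∀ {n} (j : Fin (suc n)) s → insertAt (const 0#) j 0# s ≈ 0#
    insert-zero         zero    zero    = refl
    insert-zero         zero    (suc s) = refl
    insert-zero {suc n} (suc j) zero    = refl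
    insert-zero {suc n} (suc j) (suc s) = insert-zero j s

  -- Expanding the first row into unit vectors and clearing column `j` below `δ j` leaves an
  -- alternating form in the minor. Induction evaluates it and `unit-row-sign` supplies the sign,
  -- which rebuilds the Laplace expansion of `det`.
  alternating-unique : ∀ {n} {F : Matrix n → Carrier} → Alternating F → ∀ M → F M ≈ det M * F δ
  alternating-unique {zero}      alt M = trans (cong alt λ ()) (sym (*-identityˡ _))
  alternating-unique {suc n} {F} alt M = begin
    F M
      ≈⟨ cong alt (λ { zero s → refl ; (suc r) s → refl }) ⟩
    F (head M ∷ tail M)
      ≈⟨ linear-expansion head-linear (head M) ⟩
    sum (λ j → M zero j * F (δ j ∷ tail M))
      ≈⟨ sum-cong-≋ term ⟩
    sum (λ j → sign j * (M zero j * det (minor j (tail M))) * F δ)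
      ≈⟨ *-distribʳ-sum (F δ) (λ j → sign j * (M zero j * det (minor j (tail M)))) ⟨
    det M * F δ
      ∎
    where
    head-linear : IsLinear (λ u → F (u ∷ tail M))
    head-linear a eq = linear alt zero a
      (λ { zero 0≢0 → contradiction ≡.refl 0≢0 ; (suc r) _ s → refl })
      (λ { zero 0≢0 → contradiction ≡.refl 0≢0 ; (suc r) _ s → refl })
      eq

    module _ (j : Fin (suc n)) where

      clear : F (δ j ∷ tail M) ≈ F (δ j ∷ λ r → insertAt (minor j (tail M) r) j 0#)
      clear = begin
        F (δ j ∷ tail M)
          -- Row 0 is the source of every operation and has coefficient 0 itself, as `add-rows`
          -- requires.
          ≈⟨ add-rows alt (δ j ∷ tail M) (const zero) (0# ∷ λ r → - tail M r j) (λ _ → refl) ⟨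
        F (λ i s → (δ j ∷ tail M) i s + (0# ∷ λ r → - tail M r j) i * δ j s)
          ≈⟨ cong alt (λ
               { zero    s → trans (+-congˡ (zeroˡ _)) (+-identityʳ _)
               ; (suc r) s → clear-column (tail M r) j s }) ⟩
        F (δ j ∷ λ r → insertAt (minor j (tail M) r) j 0#)
          ∎

      term : M zero j * F (δ j ∷ tail M) ≈ sign j * (M zero j * det (minor j (tail M))) * F δ
      term = begin
        M zero j * F (δ j ∷ tail M)
          ≈⟨ *-congˡ (trans clear (alternating-unique
               (alternating-map (alternating-tail alt (δ j)) (insertAt-linear j)) (minor j (tail M)))) ⟩
        M zero j * (d * F (δ j ∷ λ r → insertAt (δ r) j 0#))
          ≈⟨ *-congˡ (*-congˡ (unit-row-sign alt j)) ⟩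
        M zero j * (d * (sign j * F δ))
          ≈⟨ solve 4 (λ m d s f → m :* (d :* (s :* f)) := s :* (m :* d) :* f) refl (M zero j) d (sign j) (F δ) ⟩
        sign j * (M zero j * d) * F δ
          ∎
        where
        d : Carrier
        d = det (minor j (tail M))

  det-reindex : ∀ {n m} (π : Fin n ↔ Fin m) (M : Matrix m) →
    det (λ i j → M (Inverse.to π i) (Inverse.to π j)) ≈ det M
  det-reindex {n} {m} π M = begin
    det (λ i j → M (to i) (to j))
      ≈⟨ alternating-unique
           (alternating-reindex (alternating-map det-alternating (λ j a eq → eq (to j))) π) M ⟩
    det M * det (λ i j → δ (to i) (to j))
      -- Rows and columns move together, so the identity goes to the identity and no sign of `π`
      -- enters.
      ≈⟨ *-congˡ (trans (det-cong λ i j → reflexive (δ-injective to (Injection.injective (↔⇒↣ π)) i j)) (det-δ n)) ⟩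
    det M * 1#
      ≈⟨ *-identityʳ _ ⟩
    det M
      ∎
    where open Inverse π

  -- Determinants of block triangular matrices

  sum-split : ∀ m {n} (f : Vector Carrier (m ℕ.+ n)) →
    sum f ≈ sum (f ∘ (_↑ˡ n)) + sum (f ∘ (m ↑ʳ_))
  sum-split zero    f = sym (+-identityˡ _)
  sum-split (suc m) f = trans (+-congˡ (sum-split m (tail f))) (sym (+-assoc _ _ _))

  punchIn-↑ˡ : ∀ {m} n (j : Fin (suc m)) s → punchIn (j ↑ˡ n) (s ↑ˡ n) ≡ punchIn j s ↑ˡ n
  punchIn-↑ˡ n zero    s       = ≡.refl
  punchIn-↑ˡ n (suc j) zero    = ≡.refl
  punchIn-↑ˡ n (suc j) (suc s) = ≡.cong suc (punchIn-↑ˡ n j s)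

  punchIn-↑ʳ : ∀ {m n} (j : Fin (suc m)) (s : Fin n) → punchIn (j ↑ˡ n) (m ↑ʳ s) ≡ suc m ↑ʳ s
  punchIn-↑ʳ         zero    s = ≡.refl
  punchIn-↑ʳ {suc m} (suc j) s = ≡.cong suc (punchIn-↑ʳ j s)

  -- Laplace expansion along the first row: the right-hand columns contribute zero, and deleting a
  -- left-hand column gives a block triangular matrix with the same `Q`. The lower left block is
  -- arbitrary.
  det-block-triangular : ∀ m {n} {M : Matrix (m ℕ.+ n)} {P : Matrix m} {Q : Matrix n} →
    (∀ r s → M (r ↑ˡ n) (s ↑ˡ n) ≈ P r s) →
    (∀ r s → M (r ↑ˡ n) (m ↑ʳ s) ≈ 0#) →
    (∀ r s → M (m ↑ʳ r) (m ↑ʳ s) ≈ Q r s) →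
    det M ≈ det P * det Q
  det-block-triangular zero                    _  _   lr = trans (det-cong lr) (sym (*-identityˡ _))
  det-block-triangular (suc m) {n} {M} {P} {Q} ul ur lr = begin
    det M
      ≈⟨ sum-split (suc m) t ⟩
    sum (λ j → t (j ↑ˡ n)) + sum (λ j → t (suc m ↑ʳ j))
      ≈⟨ +-cong (sum-cong-≋ left) (sum-zero right) ⟩
    sum (λ j → sign j * (P zero j * det (minor j (tail P))) * det Q) + 0#
      ≈⟨ +-identityʳ _ ⟩
    sum (λ j → sign j * (P zero j * det (minor j (tail P))) * det Q)
      ≈⟨ *-distribʳ-sum (det Q) (λ j → sign j * (P zero j * det (minor j (tail P)))) ⟨
    det P * det Q
      ∎
    where
    t : Vector Carrier (suc m ℕ.+ n)
    t j = sign j * (M zero j * det (minor j (tail M)))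

    right : ∀ j → t (suc m ↑ʳ j) ≈ 0#
    right j = trans (*-congˡ {sign (suc m ↑ʳ j)} (trans (*-congʳ (ur zero j)) (zeroˡ _))) (zeroʳ _)

    minor-det : ∀ j → det (minor (j ↑ˡ n) (tail M)) ≈ det (minor j (tail P)) * det Q
    minor-det j = det-block-triangular m
      (λ r s → trans (reflexive (≡.cong (M (suc r ↑ˡ n)) (punchIn-↑ˡ n j s))) (ul (suc r) (punchIn j s)))
      (λ r s → trans (reflexive (≡.cong (M (suc r ↑ˡ n)) (punchIn-↑ʳ j s))) (ur (suc r) s))
      (λ r s → trans (reflexive (≡.cong (M (suc m ↑ʳ r)) (punchIn-↑ʳ j s))) (lr r s))

    left : ∀ j → t (j ↑ˡ n) ≈ sign j * (P zero j * det (minor j (tail P))) * det Q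
    left j = begin
      t (j ↑ˡ n)
        ≈⟨ *-cong (reflexive (≡.cong ((- 1#) ^_) (toℕ-↑ˡ j n))) (*-cong (ul zero j) (minor-det j)) ⟩
      sign j * (P zero j * (det (minor j (tail P)) * det Q))
        ≈⟨ solve 4 (λ s p d q → s :* (p :* (d :* q)) := s :* (p :* d) :* q)
             refl (sign j) (P zero j) (det (minor j (tail P))) (det Q) ⟩
      sign j * (P zero j * det (minor j (tail P))) * det Q
        ∎

  -- One-based lookup

  !-inside : ∀ {m} (x : Vector Carrier m) i → x ! ⟦ i ⟧ ≡ x i
  !-inside {m} x i with toℕ i ℕ.<? m
  ... | yes i<m = ≡.cong x (fromℕ<-toℕ i i<m)
  ... | no  i≮m = contradiction (toℕ<n i) i≮m

  !-outside : ∀ {m} (x : Vector Carrier m) {k} → m ≤ k → x ! suc k ≡ 0#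
  !-outside {m} x {k} m≤k with k ℕ.<? m
  ... | yes k<m = contradiction k<m (ℕ.≤⇒≯ m≤k)
  ... | no  _   = ≡.refl

  -- This also holds past the end, where both sides are the default 0; the last difference matrix
  -- relies on that.
  !-tail : ∀ {m} (x : Vector Carrier (suc m)) k → x ! suc (suc k) ≡ tail x ! suc k
  !-tail {m} x k with k ℕ.<? m
  ... | no  k≮m = !-outside x (s≤s (ℕ.≮⇒≥ k≮m))
  ... | yes k<m = ≡.trans
    (≡.cong (λ l → x ! suc l) (≡.sym (toℕ-fromℕ< (s≤s k<m))))
    (!-inside x (fromℕ< (s≤s k<m)))

  X-tail : ∀ {N m} (x : Fin N → Fin N → Vector Carrier (suc m)) i r s →
    X (λ r s → tail (x r s)) i r s ≡ X x (suc i) r s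
  X-tail x i r s = ≡.cong₂ _-_
    (≡.sym (!-tail (x r s) (toℕ i))) (≡.sym (!-tail (x r s) (suc (toℕ i))))

  -- The block matrix with entries indexed by the maximum

  open import Algebra.Properties.Monoid.Sum *-monoid
    using () renaming (sum-cong-≋ to product-cong)

  infixl 6 _⊔ᶠ_
  -- Structural recursion makes `suc i ⊔ᶠ suc j` reduce to `suc (i ⊔ᶠ j)`, so that dropping the
  -- first block row and column amounts to taking tails.
  _⊔ᶠ_ : ∀ {n} → Fin n → Fin n → Fin n
  zero  ⊔ᶠ j     = j
  suc i ⊔ᶠ zero  = suc i
  suc i ⊔ᶠ suc j = suc (i ⊔ᶠ j)

  toℕ-⊔ᶠ : ∀ {n} (i j : Fin n) → toℕ (i ⊔ᶠ j) ≡ toℕ i ℕ.⊔ toℕ j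
  toℕ-⊔ᶠ zero    j       = ≡.refl
  toℕ-⊔ᶠ (suc i) zero    = ≡.refl
  toℕ-⊔ᶠ (suc i) (suc j) = ≡.cong suc (toℕ-⊔ᶠ i j)

  maxEntry : ∀ {N m} → (Fin N → Fin N → Vector Carrier m) →
    Fin m × Fin N → Fin m × Fin N → Carrier
  maxEntry x (p , r) (q , s) = x r s (p ⊔ᶠ q)

  maxMatrix : ∀ {N m} → (Fin N → Fin N → Vector Carrier m) → Matrix (m ℕ.* N)
  maxMatrix {N} {m} x i j = maxEntry x (remQuot {m} N i) (remQuot {m} N j)

  remQuot-↑ˡ : ∀ m {N} (r : Fin N) → remQuot {suc m} N (r ↑ˡ (m ℕ.* N)) ≡ (zero , r)
  remQuot-↑ˡ m r = remQuot-combine {suc m} zero r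

  remQuot-↑ʳ : ∀ m {N} (k : Fin (m ℕ.* N)) →
    remQuot {suc m} N (N ↑ʳ k) ≡ map₁ suc (remQuot {m} N k)
  remQuot-↑ʳ m {N} k rewrite splitAt-↑ʳ N (m ℕ.* N) k = ≡.refl

  det-maxMatrix : ∀ {N} m (x : Fin N → Fin N → Vector Carrier m) →
    det (maxMatrix x) ≈ product (λ i → det (X x i))
  det-maxMatrix     zero    x = refl
  det-maxMatrix {N} (suc m) x = begin
    det (maxMatrix x)
      ≈⟨ first-block m x ⟩
    det (X x zero) * det (maxMatrix (λ r s → tail (x r s)))
      ≈⟨ *-congˡ (det-maxMatrix m (λ r s → tail (x r s))) ⟩
    det (X x zero) * product (λ i → det (X (λ r s → tail (x r s)) i))
      ≈⟨ *-congˡ (product-cong λ i → det-cong λ r s → reflexive (X-tail x i r s)) ⟩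
    product (λ i → det (X x i))
      ∎
    where
    first-block : ∀ m (x : Fin N → Fin N → Vector Carrier (suc m)) →
      det (maxMatrix x) ≈ det (X x zero) * det (maxMatrix (λ r s → tail (x r s)))
    -- With a single block there is no second block row to subtract; the subtrahend is the default
    -- `x₂ = 0`, and the remaining blocks are empty.
    first-block zero x = det-block-triangular N {Q = maxMatrix (λ r s → tail (x r s))}
      (λ r s → begin
        maxMatrix x (r ↑ˡ 0) (s ↑ˡ 0)      ≡⟨ ≡.cong₂ (maxEntry x) (remQuot-↑ˡ 0 r) (remQuot-↑ˡ 0 s) ⟩
        x r s zero                         ≈⟨ +-identityʳ _ ⟨
        x r s zero + 0#                    ≈⟨ +-congˡ -0#≈0# ⟨
        x r s zero - 0#
          ≡⟨ ≡.cong₂ _-_ (!-inside (x r s) zero) (!-outside (x r s) {1} ℕ.≤-refl) ⟨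
        X x zero r s                       ∎)
      (λ _ ())
      (λ ())
    first-block (suc m) x = begin
      det M
        ≈⟨ add-rows det-alternating M source weight weight∘source≈0 ⟨
      det (λ i s → M i s + weight i * M (source i) s)
        ≈⟨ det-block-triangular N upper-left upper-right lower-right ⟩
      det (X x zero) * det (maxMatrix (λ r s → tail (x r s)))
        ∎
      where
      b : ℕ
      b = m ℕ.* N

      M : Matrix (N ℕ.+ (N ℕ.+ b))
      M = maxMatrix x

      -- Row `r` of the first block row receives -1 times row `r` of the second. Every other row is
      -- its own source with weight 0, so no source lies in the first block row.
      source : Fin (N ℕ.+ (N ℕ.+ b)) → Fin (N ℕ.+ (N ℕ.+ b))
      source = [ (λ r → N ↑ʳ (r ↑ˡ b)) , N ↑ʳ_ ]′ ∘ splitAt N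

      weight : Vector Carrier (N ℕ.+ (N ℕ.+ b))
      weight = [ const (- 1#) , const 0# ]′ ∘ splitAt N

      weight-↑ʳ : ∀ k → weight (N ↑ʳ k) ≈ 0#
      weight-↑ʳ k = reflexive (≡.cong [ const (- 1#) , const 0# ]′ (splitAt-↑ʳ N (N ℕ.+ b) k))

      weight∘source≈0 : ∀ i → weight (source i) ≈ 0#
      weight∘source≈0 i with splitAt N i
      ... | inj₁ r = weight-↑ʳ (r ↑ˡ b)
      ... | inj₂ k = weight-↑ʳ k

      upper : ∀ r j → M (r ↑ˡ (N ℕ.+ b)) j + weight (r ↑ˡ (N ℕ.+ b)) * M (source (r ↑ˡ (N ℕ.+ b))) j ≈
        maxEntry x (zero , r) (remQuot N j) - maxEntry x (suc zero , r) (remQuot N j)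
      upper r j = trans
        (+-cong
          (reflexive (≡.cong (λ z → maxEntry x z (remQuot N j)) (remQuot-↑ˡ (suc m) r)))
          (reflexive (≡.cong₂ _*_
            (≡.cong [ const (- 1#) , const 0# ]′ split)
            (≡.cong (λ z → maxEntry x z (remQuot N j)) below))))
        (+-congˡ (-1*x≈-x _))
        where
        split : splitAt N (r ↑ˡ (N ℕ.+ b)) ≡ inj₁ r
        split = splitAt-↑ˡ N r (N ℕ.+ b)

        below : remQuot N (source (r ↑ˡ (N ℕ.+ b))) ≡ (suc zero , r)
        below = ≡.trans
          (≡.cong (remQuot N ∘ [ (λ r → N ↑ʳ (r ↑ˡ b)) , N ↑ʳ_ ]′) split)
          (≡.trans (remQuot-↑ʳ (suc m) (r ↑ˡ b)) (≡.cong (map₁ suc) (remQuot-↑ˡ m r)))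

      upper-left : ∀ r s → M (r ↑ˡ (N ℕ.+ b)) (s ↑ˡ (N ℕ.+ b)) +
        weight (r ↑ˡ (N ℕ.+ b)) * M (source (r ↑ˡ (N ℕ.+ b))) (s ↑ˡ (N ℕ.+ b)) ≈ X x zero r s
      upper-left r s = begin
        _
          ≈⟨ upper r (s ↑ˡ (N ℕ.+ b)) ⟩
        maxEntry x (zero , r) (remQuot N (s ↑ˡ (N ℕ.+ b))) - maxEntry x (suc zero , r) (remQuot N (s ↑ˡ (N ℕ.+ b)))
          ≡⟨ ≡.cong (λ z → maxEntry x (zero , r) z - maxEntry x (suc zero , r) z) (remQuot-↑ˡ (suc m) s) ⟩
        x r s zero - x r s (suc zero)
          ≡⟨ ≡.cong₂ _-_ (!-inside (x r s) zero) (!-inside (x r s) (suc zero)) ⟨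
        X x zero r s
          ∎

      upper-right : ∀ r k → M (r ↑ˡ (N ℕ.+ b)) (N ↑ʳ k) +
        weight (r ↑ˡ (N ℕ.+ b)) * M (source (r ↑ˡ (N ℕ.+ b))) (N ↑ʳ k) ≈ 0#
      upper-right r k = begin
        _
          ≈⟨ upper r (N ↑ʳ k) ⟩
        maxEntry x (zero , r) (remQuot N (N ↑ʳ k)) - maxEntry x (suc zero , r) (remQuot N (N ↑ʳ k))
          ≡⟨ ≡.cong (λ z → maxEntry x (zero , r) z - maxEntry x (suc zero , r) z) (remQuot-↑ʳ (suc m) k) ⟩
        maxEntry x (zero , r) (map₁ suc (remQuot N k)) - maxEntry x (suc zero , r) (map₁ suc (remQuot N k))
          -- For a column position `suc q`, the maxima with 0 and with 1 both reduce to `suc q`, so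
          -- the two entries coincide.
          ≈⟨ -‿inverseʳ _ ⟩
        0#
          ∎

      lower-right : ∀ i j → M (N ↑ʳ i) (N ↑ʳ j) + weight (N ↑ʳ i) * M (source (N ↑ʳ i)) (N ↑ʳ j) ≈
        maxMatrix (λ r s → tail (x r s)) i j
      lower-right i j = begin
        M (N ↑ʳ i) (N ↑ʳ j) + weight (N ↑ʳ i) * M (source (N ↑ʳ i)) (N ↑ʳ j)
          ≈⟨ +-cong (reflexive (≡.cong₂ (maxEntry x) (remQuot-↑ʳ (suc m) i) (remQuot-↑ʳ (suc m) j)))
                   (trans (*-congʳ (weight-↑ʳ i)) (zeroˡ _)) ⟩
        maxMatrix (λ r s → tail (x r s)) i j + 0#
          ≈⟨ +-identityʳ _ ⟩
        maxMatrix (λ r s → tail (x r s)) i j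
          ∎

  -- Reversal inside even blocks and regrouping by position

  position : ∀ {m} → Parity → Fin m → Fin m
  position 1ℙ p = p
  position 0ℙ p = opposite p

  position-involutive : ∀ {m} ρ (p : Fin m) → position ρ (position ρ p) ≡ p
  position-involutive 1ℙ p = ≡.refl
  position-involutive 0ℙ p = opposite-involutive p

  -- Links the complements `m + 1 - p` in `A`, `C` and `D` with the reversal of `Fin m`.
  ⟦opposite⟧ : ∀ {m} (p : Fin m) → suc m ℕ.∸ ⟦ p ⟧ ≡ ⟦ opposite p ⟧
  ⟦opposite⟧ {m} p = ≡.trans (ℕ.+-∸-assoc 1 (toℕ<n p)) (≡.cong suc (≡.sym (opposite-prop p)))

  block-entry : ∀ {m} ρ σ (x : Vector Carrier m) p q →
    block ρ σ x p q ≡ x (position ρ p ⊔ᶠ position σ q)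
  block-entry {m} ρ σ x p q = ≡.trans (lookup ρ σ)
    (≡.trans (≡.cong (λ k → x ! suc k) (≡.sym (toℕ-⊔ᶠ (position ρ p) (position σ q)))) (!-inside x _))
    where
    lookup : ∀ ρ σ → block ρ σ x p q ≡ x ! (⟦ position ρ p ⟧ ℕ.⊔ ⟦ position σ q ⟧)
    lookup 1ℙ 1ℙ = ≡.refl
    lookup 1ℙ 0ℙ = ≡.cong (λ k → x ! (⟦ p ⟧ ℕ.⊔ k)) (⟦opposite⟧ q)
    lookup 0ℙ 1ℙ = ≡.cong (λ k → x ! (k ℕ.⊔ ⟦ q ⟧)) (⟦opposite⟧ p)
    -- Taking complements turns the minimum in `A` into a maximum.
    lookup 0ℙ 0ℙ = ≡.cong (x !_) (≡.trans
      (ℕ.∸-distribˡ-⊓-⊔ (suc m) ⟦ p ⟧ ⟦ q ⟧) (≡.cong₂ ℕ._⊔_ (⟦opposite⟧ p) (⟦opposite⟧ q)))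

  module _ (N m : ℕ) where

    -- The reversal depends only on the block `r`, which is kept, so applying it a second time
    -- inverts it.
    reorderPair : (Fin N × Fin m) ↔ (Fin m × Fin N)
    reorderPair = mk↔ₛ′
      (λ (r , p) → position (parity ⟦ r ⟧) p , r)
      (λ (p , r) → r , position (parity ⟦ r ⟧) p)
      (λ (p , r) → ≡.cong (_, r) (position-involutive (parity ⟦ r ⟧) p))
      (λ (r , p) → ≡.cong (r ,_) (position-involutive (parity ⟦ r ⟧) p))

    reorder : Fin (N ℕ.* m) ↔ Fin (m ℕ.* N)
    reorder = ↔-trans (*↔× {N} {m}) (↔-trans reorderPair (↔-sym (*↔× {m} {N})))

    G-reorder : ∀ (x : Fin N → Fin N → Vector Carrier m) i j →
      G N m x i j ≡ maxMatrix x (Inverse.to reorder i) (Inverse.to reorder j)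
    G-reorder x i j = ≡.trans (block-entry (parity ⟦ r ⟧) (parity ⟦ s ⟧) (x r s) p q)
      (≡.sym (≡.cong₂ (maxEntry x) (remQuot-combine _ r) (remQuot-combine _ s)))
      where
      r = proj₁ (remQuot {N} m i)
      p = proj₂ (remQuot {N} m i)
      s = proj₁ (remQuot {N} m j)
      q = proj₂ (remQuot {N} m j)

theorem4p1 : ∀ {c ℓ} (R : CommutativeRing c ℓ) →
    let open CommutativeRing R
        open Matrices R in
    (N m : ℕ) → 2 ≤ N → 1 ≤ m →
    (x : Fin N → Fin N → Vector Carrier m) →
    det (G N m x) ≈ product (λ i → det (X x i))
theorem4p1 R N m _ _ x = begin
  det (G N m x)
    ≈⟨ det-cong (λ i j → reflexive (G-reorder N m x i j)) ⟩
  det (λ i j → maxMatrix x (Inverse.to (reorder N m) i) (Inverse.to (reorder N m) j))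
    ≈⟨ det-reindex (reorder N m) (maxMatrix x) ⟩
  det (maxMatrix x)
    ≈⟨ det-maxMatrix m x ⟩
  product (λ i → det (X x i))
    ∎
  where
  open CommutativeRing R
  open Matrices R
  open Determinants R
  open import Relation.Binary.Reasoning.Setoid setoid
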